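{- There exist an infinite set $S$ of positive integers and, for each $N \in S$, a Newman polynomial $p_N$ of degree $N$ such that $$ \liminf_{N \to \infty,\ N \in S} \frac{N\, \|p_N^2\|_\infty}{p_N^2(1)} < 1 $$ and $$ \frac{p_N(1)}{N} \to 0 \quad \text{as } N \to \infty,\ N \in S. $$
   Context: A Newman polynomial is a polynomial in one variable all of whose coefficients are 0 or 1. For a polynomial $q$, $\|q\|_\infty$ denotes the maximum of the absolute values of its coefficients. Here $p_N^2$ is the square of the polynomial $p_N$, and $p_N^2(1) = (p_N(1))^2$ is its value at $1$. -}

module Defs where

open import Data.Integer.Base as ℤ using (ℤ; +_; -[1+_]; 0ℤ; 1ℤ)
open import Data.List.Base using (List; []; _∷_; map; foldr)
open import Data.Nat.Base as ℕ using (ℕ; zero; suc; _⊔_)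
open import Data.Product using (∃; Σ; ∃-syntax; Σ-syntax; _×_; _,_; proj₁)
open import Data.Rational.Base as ℚ using (ℚ; 0ℚ; _<_; _/_)
open import Data.Rational.Properties using (<-trans; <-dense)
open import Data.Sum.Base using (_⊎_)
open import Level using (0ℓ)
open import Relation.Binary.PropositionalEquality.Core using (_≡_; _≢_)
open import Relation.Unary using (Pred; _∈_)

-- Integer polynomials in one variable, as coefficient lists with the constant
-- term first.  Trailing zeros are allowed; nothing below depends on them.

Poly : Set
Poly = List ℤ

coeff : Poly → ℕ → ℤ
coeff []      k       = 0ℤ
coeff (a ∷ p) zero    = a
coeff (a ∷ p) (suc k) = coeff p k

infixl 6 _+ₚ_
infixl 7 _*ₚ_
infixr 8 _²

_+ₚ_ : Poly → Poly → Poly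
[]      +ₚ q       = q
(a ∷ p) +ₚ []      = a ∷ p
(a ∷ p) +ₚ (b ∷ q) = (a ℤ.+ b) ∷ (p +ₚ q)

-- (a + x p) q = a q + x (p q)
_*ₚ_ : Poly → Poly → Poly
[]      *ₚ q = []
(a ∷ p) *ₚ q = map (a ℤ.*_) q +ₚ (0ℤ ∷ (p *ₚ q))

_² : Poly → Poly
p ² = p *ₚ p

eval : Poly → ℤ → ℤ
eval []      x = 0ℤ
eval (a ∷ p) x = a ℤ.+ x ℤ.* eval p x

‖_‖∞ : Poly → ℕ
‖ p ‖∞ = foldr (λ a m → ℤ.∣ a ∣ ⊔ m) 0 p

HasDegree : Poly → ℕ → Set
HasDegree p n = coeff p n ≢ 0ℤ × (∀ k → n ℕ.< k → coeff p k ≡ 0ℤ)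

Newman : Poly → Set
Newman p = ∀ k → coeff p k ≡ 0ℤ ⊎ coeff p k ≡ 1ℤ

Infinite : Pred ℕ 0ℓ → Set
Infinite S = ∀ M → ∃[ N ] (M ℕ.≤ N × N ∈ S)

-- The quotient of two integers, made total by i ÷ 0 = 0.
infixl 7 _÷_
_÷_ : ℤ → ℤ → ℚ
i ÷ (+ zero)    = 0ℚ
i ÷ (+ (suc n)) = i / suc n
i ÷ -[1+ n ]    = (ℤ.- i) / suc n

-- Extended reals presented by their upper cuts: x corresponds to the set of
-- rationals q with x < q, so "below x q" means x < q.  The empty cut is +∞ and
-- the full one is -∞.  This presentation has all infima and suprema, hence the
-- lower limit of any sequence, without locatedness assumptions.

record Upperℝ : Set₁ where
  field
    below   : ℚ → Set
    upward  : ∀ {q r} → q < r → below q → below r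
    rounded : ∀ {r} → below r → ∃[ q ] (q < r × below q)

open Upperℝ public

infix 4 _<ᵘ_
_<ᵘ_ : Upperℝ → ℚ → Set
x <ᵘ q = below x q

fromℚ : ℚ → Upperℝ
fromℚ r = record
  { below   = λ q → r < q
  ; upward  = λ q<r x<q → <-trans x<q q<r
  ; rounded = λ x<r → let m , x<m , m<r = <-dense x<r in m , m<r , x<m
  }

inf : {I : Set} → (I → Upperℝ) → Upperℝ
inf x = record
  { below   = λ q → ∃[ i ] (x i <ᵘ q)
  ; upward  = λ q<r (i , xᵢ<q) → i , upward (x i) q<r xᵢ<q
  ; rounded = λ (i , xᵢ<r) →
      let q , q<r , xᵢ<q = rounded (x i) xᵢ<r in q , q<r , i , xᵢ<q
  }

-- All x i < q does not give sup x < q; a rational r < q with x i < r for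
-- every i is needed.
sup : {I : Set} → (I → Upperℝ) → Upperℝ
sup x = record
  { below   = λ q → ∃[ r ] (r < q × (∀ i → x i <ᵘ r))
  ; upward  = λ q<s (r , r<q , x<r) → r , <-trans r<q q<s , x<r
  ; rounded = λ (r , r<q , x<r) →
      let m , r<m , m<q = <-dense r<q in m , m<q , r , r<m , x<r
  }

-- sup over M of inf { a N | N ≥ M, N ∈ S }
liminf : Pred ℕ 0ℓ → (ℕ → ℚ) → Upperℝ
liminf S a = sup λ M →
  inf {I = Σ[ N ∈ ℕ ] (M ℕ.≤ N × N ∈ S)} λ i → fromℚ (a (proj₁ i))

-- a N → ℓ as N → ∞ with N ∈ S
Converges : Pred ℕ 0ℓ → (ℕ → ℚ) → ℚ → Set
Converges S a ℓ = ∀ ε → 0ℚ < ε →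
  ∃[ M ] (∀ N → M ℕ.≤ N → N ∈ S → ℚ.∣ a N ℚ.- ℓ ∣ < ε)

{-# OPTIONS --safe #-}
module Submission where

open import Defs
open import Data.Integer.Base as ℤ using (+_; -[1+_]; 0ℤ; 1ℤ; +<+)
import Data.Integer.Properties as ℤ
import Data.Integer.Tactic.RingSolver as ℤ-Solver
open import Data.List.Base using (List; []; _∷_; _++_; map; length; replicate; concatMap)
open import Data.List.Properties
open import Data.List.Relation.Unary.All as All using (All; []; _∷_)
import Data.List.Relation.Unary.All.Properties as All
open import Data.Nat.Base
open import Data.Nat.Divisibility.Core using (divides-refl)
open import Data.Nat.DivMod
open import Data.Nat.Properties
open import Data.Nat.Tactic.RingSolver using (solve-∀)
open import Data.Product using (Σ-syntax; ∃-syntax; _×_; _,_; proj₁; proj₂)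
open import Data.Rational.Base as ℚ using (mkℚ; 0ℚ; 1ℚ)
import Data.Rational.Properties as ℚ
open import Data.Rational.Unnormalised.Base as ℚᵘ using (mkℚᵘ)
import Data.Rational.Unnormalised.Properties as ℚᵘ
open import Data.Sum.Base using (inj₁; inj₂)
open import Function.Base using (_∘_)
open import Level using (0ℓ)
open import Relation.Binary.PropositionalEquality
open import Relation.Nullary using (Dec; yes; no; contradiction)
open import Relation.Unary using (Pred; _∈_)

-- For 0/1 polynomials h and f, with f of length n, every coefficient of the
-- square of h(xⁿ) f(x) is at most max h² times the largest coefficient of f²
-- modulo xⁿ - 1.  For h = 1 + x + x³ the ratio (deg + 1) max h² / h(1)² is 8/9,
-- so it suffices to use enough factors f to push the density to 0 while their
-- total cost in the ratio stays below 9/8.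
--
-- Let f be the complement modulo n of a set of k residues in which every
-- residue has at most r ≤ k representations as a sum of two elements.  With
-- F = n - k, each such factor multiplies the ratio by at most 1 + r/F and the
-- density by F/(F + k).  If k/r is large, about F/(17 r) factors keep the ratio
-- below 8/9 · 17/16 while the density is small.  Such a set comes from
-- iterating {0,1,3} in base 8, which gives k/r = (3/2)ʲ⁺¹.

-- Square coefficients of digit products

-- Values at 1, coefficients and cyclic coefficients are all sums of one list against different
-- weights, so a single calculus of weighted sums serves every count.
infixr 4 _·_
_·_ : List ℕ → (ℕ → ℕ) → ℕ
[]      · φ = 0
(a ∷ p) · φ = a * φ 0 + (p · (φ ∘ suc))

·-cong : ∀ p {φ ψ} → (∀ i → φ i ≡ ψ i) → (p · φ) ≡ (p · ψ)
·-cong []      φ≡ψ = refl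
·-cong (a ∷ p) φ≡ψ = cong₂ (λ x y → a * x + y) (φ≡ψ 0) (·-cong p (φ≡ψ ∘ suc))

·-mono-< : ∀ p {φ ψ} → (∀ i → i < length p → φ i ≤ ψ i) → (p · φ) ≤ (p · ψ)
·-mono-< []      φ≤ψ = z≤n
·-mono-< (a ∷ p) φ≤ψ =
  +-mono-≤ (*-monoʳ-≤ a (φ≤ψ 0 z<s)) (·-mono-< p λ i i<n → φ≤ψ (suc i) (s<s i<n))

·-mono : ∀ p {φ ψ} → (∀ i → φ i ≤ ψ i) → (p · φ) ≤ (p · ψ)
·-mono p φ≤ψ = ·-mono-< p λ i _ → φ≤ψ i

·-zero : ∀ p → (p · λ _ → 0) ≡ 0
·-zero []      = refl
·-zero (a ∷ p) = cong₂ _+_ (*-zeroʳ a) (·-zero p)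

·-+ : ∀ p φ ψ → (p · λ i → φ i + ψ i) ≡ (p · φ) + (p · ψ)
·-+ []      φ ψ = refl
·-+ (a ∷ p) φ ψ rewrite ·-+ p (φ ∘ suc) (ψ ∘ suc) =
  distribute a (φ 0) (ψ 0) (p · (φ ∘ suc)) (p · (ψ ∘ suc))
  where
  distribute : ∀ a x y s t → a * (x + y) + (s + t) ≡ (a * x + s) + (a * y + t)
  distribute = solve-∀

·-*ʳ : ∀ p φ c → (p · λ i → φ i * c) ≡ (p · φ) * c
·-*ʳ []      φ c = refl
·-*ʳ (a ∷ p) φ c rewrite ·-*ʳ p (φ ∘ suc) c = distribute a (φ 0) (p · (φ ∘ suc)) c
  where
  distribute : ∀ a x s c → a * (x * c) + s * c ≡ (a * x + s) * c
  distribute = solve-∀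

·-swap : ∀ p q (φ : ℕ → ℕ → ℕ) →
         (p · λ i → q · λ j → φ i j) ≡ (q · λ j → p · λ i → φ i j)
·-swap []      q φ = sym (·-zero q)
·-swap (a ∷ p) q φ = begin
  a * (q · φ 0) + (p · λ i → q · φ (suc i))
    ≡⟨ cong₂ _+_ (*-comm a _) (·-swap p q (φ ∘ suc)) ⟩
  (q · φ 0) * a + (q · λ j → p · λ i → φ (suc i) j)
    ≡⟨ cong (_+ _) (·-*ʳ q (φ 0) a) ⟨
  (q · λ j → φ 0 j * a) + (q · λ j → p · λ i → φ (suc i) j)
    ≡⟨ ·-+ q _ _ ⟨
  (q · λ j → φ 0 j * a + (p · λ i → φ (suc i) j))
    ≡⟨ ·-cong q (λ j → cong (_+ (p · λ i → φ (suc i) j)) (*-comm (φ 0 j) a)) ⟩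
  (q · λ j → a * φ 0 j + (p · λ i → φ (suc i) j)) ∎
  where open ≡-Reasoning

·-++ : ∀ p q φ → ((p ++ q) · φ) ≡ (p · φ) + (q · λ i → φ (length p + i))
·-++ []      q φ = refl
·-++ (a ∷ p) q φ =
  trans (cong (λ x → a * φ 0 + x) (·-++ p q (φ ∘ suc))) (sym (+-assoc (a * φ 0) _ _))

·-map-* : ∀ b p φ → (map (b *_) p · φ) ≡ b * (p · φ)
·-map-* b []      φ = sym (*-zeroʳ b)
·-map-* b (a ∷ p) φ rewrite ·-map-* b p (φ ∘ suc) = distribute b a (φ 0) (p · (φ ∘ suc))
  where
  distribute : ∀ b a x s → b * a * x + b * s ≡ b * (a * x + s)
  distribute = solve-∀

·-replicate-0 : ∀ n φ → (replicate n 0 · φ) ≡ 0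
·-replicate-0 zero    φ = refl
·-replicate-0 (suc n) φ = ·-replicate-0 n (φ ∘ suc)

·-replicate-snoc : ∀ n φ → (replicate (suc n) 1 · φ) ≡ (replicate n 1 · φ) + φ n
·-replicate-snoc zero    φ = trans (+-identityʳ _) (*-identityˡ _)
·-replicate-snoc (suc n) φ =
  trans (cong (λ x → 1 * φ 0 + x) (·-replicate-snoc n (φ ∘ suc))) (sym (+-assoc (1 * φ 0) _ _))

total : List ℕ → ℕ
total p = p · λ _ → 1

·-const : ∀ p c → (p · λ _ → c) ≡ total p * c
·-const p c = trans (·-cong p (λ _ → sym (*-identityˡ c))) (·-*ʳ p (λ _ → 1) c)

-- The coefficients of p² weighted by φ; sq p (δ m) is the m-th one.
sq : List ℕ → (ℕ → ℕ) → ℕ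
sq p φ = p · λ i → p · λ j → φ (i + j)

sq-mono : ∀ p {φ ψ} → (∀ i → φ i ≤ ψ i) → sq p φ ≤ sq p ψ
sq-mono p φ≤ψ = ·-mono p λ i → ·-mono p λ j → φ≤ψ (i + j)

sq-*ʳ : ∀ p φ c → sq p (λ i → φ i * c) ≡ sq p φ * c
sq-*ʳ p φ c = trans (·-cong p λ i → ·-*ʳ p (λ j → φ (i + j)) c) (·-*ʳ p _ c)

-- The Kronecker delta, by double recursion so that a common shift of both arguments cancels by
-- computation.
δ : ℕ → ℕ → ℕ
δ zero    zero    = 1
δ zero    (suc _) = 0
δ (suc _) zero    = 0
δ (suc m) (suc i) = δ m i

δ-refl : ∀ m → δ m m ≡ 1
δ-refl zero    = refl
δ-refl (suc m) = δ-refl m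

δ-≤ : ∀ m i {x} → (m ≡ i → 1 ≤ x) → δ m i ≤ x
δ-≤ zero    zero    h = h refl
δ-≤ zero    (suc i) h = z≤n
δ-≤ (suc m) zero    h = z≤n
δ-≤ (suc m) (suc i) h = δ-≤ m i (h ∘ cong suc)

-- As a weight in `sq p` this yields the coefficient of p² modulo xⁿ - 1 at the residue of `m`.
χ : ∀ n .{{_ : NonZero n}} → ℕ → ℕ → ℕ
χ n m i = δ (m % n) (i % n)

Bounded : ℕ → List ℕ → Set
Bounded h p = ∀ m → sq p (δ m) ≤ h

CyclicallyBounded : ∀ n .{{_ : NonZero n}} → ℕ → List ℕ → Set
CyclicallyBounded n r p = ∀ m → sq p (χ n m) ≤ r

-- h ⊗ f is h(xⁿ) f(x), where n is the length of f.
infixl 6 _⊗_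
_⊗_ : List ℕ → List ℕ → List ℕ
h ⊗ f = concatMap (λ b → map (b *_) f) h

·-⊗ : ∀ h f φ → (h ⊗ f · φ) ≡ (h · λ u → f · λ r → φ (u * length f + r))
·-⊗ []      f φ = refl
·-⊗ (b ∷ h) f φ = begin
  ((map (b *_) f ++ (h ⊗ f)) · φ)
    ≡⟨ ·-++ (map (b *_) f) (h ⊗ f) φ ⟩
  (map (b *_) f · φ) + (h ⊗ f · λ i → φ (length (map (b *_) f) + i))
    ≡⟨ cong₂ _+_ (·-map-* b f φ)
         (trans (·-⊗ h f _) (·-cong h λ u → ·-cong f λ r → cong φ (shift u r))) ⟩
  b * (f · φ) + (h · λ u → f · λ r → φ (suc u * length f + r)) ∎
  where
  open ≡-Reasoning
  shift : ∀ u r → length (map (b *_) f) + (u * length f + r) ≡ suc u * length f + r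
  shift u r rewrite length-map (b *_) f = sym (+-assoc (length f) _ r)

length-⊗ : ∀ h f → length (h ⊗ f) ≡ length h * length f
length-⊗ []      f = refl
length-⊗ (b ∷ h) f =
  trans (length-++ (map (b *_) f)) (cong₂ _+_ (length-map (b *_) f) (length-⊗ h f))

total-⊗ : ∀ h f → total (h ⊗ f) ≡ total h * total f
total-⊗ h f = trans (·-⊗ h f _) (·-const h (total f))

-- Indices split into a high and a low digit in base `length f`, and exchanging sums moves both low
-- digits outside. Their sum `t` stays unreduced and may carry.
sq-⊗ : ∀ h f φ →
       sq (h ⊗ f) φ ≡ sq f (λ t → sq h (λ w → φ (w * length f + t)))
sq-⊗ h f φ = begin
  (h ⊗ f · λ i → h ⊗ f · λ j → φ (i + j))
    ≡⟨ ·-⊗ h f _ ⟩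
  (h · λ u → f · λ r → h ⊗ f · λ j → φ (u * n + r + j))
    ≡⟨ ·-cong h (λ u → ·-cong f λ r → ·-⊗ h f _) ⟩
  (h · λ u → f · λ r → h · λ v → f · λ s → φ (u * n + r + (v * n + s)))
    ≡⟨ ·-cong h (λ u → ·-cong f λ r → ·-swap h f _) ⟩
  (h · λ u → f · λ r → f · λ s → h · λ v → φ (u * n + r + (v * n + s)))
    ≡⟨ ·-swap h f _ ⟩
  (f · λ r → h · λ u → f · λ s → h · λ v → φ (u * n + r + (v * n + s)))
    ≡⟨ ·-cong f (λ r → ·-swap h f _) ⟩
  (f · λ r → f · λ s → h · λ u → h · λ v → φ (u * n + r + (v * n + s)))
    ≡⟨ ·-cong f (λ r → ·-cong f λ s → ·-cong h λ u → ·-cong h λ v →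
         cong φ (regroup u v n r s)) ⟩
  (f · λ r → f · λ s → h · λ u → h · λ v → φ ((u + v) * n + (r + s))) ∎
  where
  open ≡-Reasoning
  n = length f
  regroup : ∀ u v n r s → u * n + r + (v * n + s) ≡ (u + v) * n + (r + s)
  regroup = solve-∀

-- If m = wn + t, then w = m/n - t/n and t ≡ m modulo n. Truncated subtraction can make the right
-- side 1 where the left is 0, which an upper bound tolerates.
δ-digit : ∀ n .{{_ : NonZero n}} m w t →
          δ m (w * n + t) ≤ δ (m / n ∸ t / n) w * χ n m t
δ-digit n m w t = δ-≤ m (w * n + t) λ { refl → ≤-reflexive (sym (cong₂ _*_ quotient residue)) }
  where
  m′ = w * n + t
  quotient : δ (m′ / n ∸ t / n) w ≡ 1
  quotient = trans (cong (λ x → δ x w) w≡) (δ-refl w)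
    where
    w≡ : m′ / n ∸ t / n ≡ w
    w≡ = trans (cong (_∸ t / n) (trans (+-distrib-/-∣ˡ t (divides-refl w))
                                       (cong (_+ t / n) (m*n/n≡m w n))))
               (m+n∸n≡m w (t / n))
  residue : χ n m′ t ≡ 1
  residue = trans (cong (λ x → δ x (t % n)) t≡) (δ-refl (t % n))
    where
    t≡ : m′ % n ≡ t % n
    t≡ = trans (cong (_% n) (+-comm (w * n) t)) ([m+kn]%n≡m%n t w n)

-- A carry out of the low digits only moves the coefficient of h² that is
-- used, so the carries of f² merge into its cyclic coefficients.
⊗-bounded : ∀ {n} .{{_ : NonZero n}} {a r} h f → length f ≡ n →
            Bounded a h → CyclicallyBounded n r f → Bounded (r * a) (h ⊗ f)
⊗-bounded {n} {a} {r} h f refl bh bf m = begin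
  sq (h ⊗ f) (δ m)
    ≡⟨ sq-⊗ h f (δ m) ⟩
  sq f (λ t → sq h (λ w → δ m (w * n + t)))
    ≤⟨ sq-mono f (λ t → sq-mono h λ w → δ-digit n m w t) ⟩
  sq f (λ t → sq h (λ w → δ (m / n ∸ t / n) w * χ n m t))
    ≤⟨ sq-mono f (λ t → ≤-trans (≤-reflexive (sq-*ʳ h (δ (m / n ∸ t / n)) (χ n m t)))
                                (*-monoˡ-≤ (χ n m t) (bh (m / n ∸ t / n)))) ⟩
  sq f (λ t → a * χ n m t)
    ≡⟨ ·-cong f (λ i → ·-cong f λ j → *-comm a _) ⟩
  sq f (λ t → χ n m t * a)
    ≡⟨ sq-*ʳ f (χ n m) a ⟩
  sq f (χ n m) * a
    ≤⟨ *-monoˡ-≤ a (bf m) ⟩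
  r * a ∎
  where open ≤-Reasoning

·-pad : ∀ p z φ → (p ++ replicate z 0 · φ) ≡ (p · φ)
·-pad p z φ = trans (·-++ p (replicate z 0) φ)
                    (trans (cong (λ x → (p · φ) + x) (·-replicate-0 z _)) (+-identityʳ _))

-- All exponents in p² are below n, so reduction modulo xⁿ - 1 merges none of them and cyclic
-- coefficients are ordinary ones.
pad-bounded : ∀ {n} .{{_ : NonZero n}} {a} p z → length p + length p ≤ n →
              Bounded a p → CyclicallyBounded n a (p ++ replicate z 0)
pad-bounded {n} {a} p z 2l≤n bp m = begin
  sq (p ++ replicate z 0) (χ n m)
    ≡⟨ ·-pad p z _ ⟩
  (p · λ i → p ++ replicate z 0 · λ j → χ n m (i + j))
    ≡⟨ ·-cong p (λ i → ·-pad p z _) ⟩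
  sq p (χ n m)
    ≤⟨ ·-mono-< p (λ i i<l → ·-mono-< p λ j j<l → ≤-reflexive
         (cong (δ (m % n)) (m<n⇒m%n≡m (<-≤-trans (+-mono-< i<l j<l) 2l≤n)))) ⟩
  sq p (δ (m % n))
    ≤⟨ bp (m % n) ⟩
  a ∎
  where open ≤-Reasoning

-- Complements modulo n

·-replicate-δ : ∀ {c n} → c < n → (replicate n 1 · δ c) ≡ 1
·-replicate-δ {zero}  {suc n} c<n = cong suc (·-zero (replicate n 1))
·-replicate-δ {suc c} {suc n} c<n = ·-replicate-δ (s<s⁻¹ c<n)


-- Any n consecutive integers meet each residue class once. Induction on the start of the window: a
-- shift loses `ψ 0` and gains `ψ n`, whose arguments are congruent, and both windows sit in one of
-- length n + 1.
period : ∀ n .{{_ : NonZero n}} m r → (replicate n 1 · λ s → χ n m (r + s)) ≡ 1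
period n m zero = trans
  (≤-antisym (·-mono-< (replicate n 1) λ s s<n → ≤-reflexive (small s s<n))
             (·-mono-< (replicate n 1) λ s s<n → ≤-reflexive (sym (small s s<n))))
  (·-replicate-δ (m%n<n m n))
  where
  small : ∀ s → s < length (replicate n 1) → χ n m s ≡ δ (m % n) s
  small s s<n = cong (δ (m % n)) (m<n⇒m%n≡m (subst (s <_) (length-replicate n) s<n))
period n m (suc r) = +-cancelˡ-≡ (ψ 0) _ 1 (begin
  ψ 0 + (replicate n 1 · λ s → χ n m (suc r + s))
    ≡⟨ cong₂ _+_ (*-identityˡ (ψ 0)) (·-cong (replicate n 1) λ s → cong (χ n m) (+-suc r s)) ⟨
  (replicate (suc n) 1 · ψ)
    ≡⟨ ·-replicate-snoc n ψ ⟩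
  (replicate n 1 · ψ) + ψ n
    ≡⟨ cong₂ _+_ (period n m r) (cong (δ (m % n)) wrap) ⟩
  1 + ψ 0
    ≡⟨ +-comm 1 (ψ 0) ⟩
  ψ 0 + 1 ∎)
  where
  open ≡-Reasoning
  ψ : ℕ → ℕ
  ψ s = χ n m (r + s)
  wrap : (r + n) % n ≡ (r + 0) % n
  wrap = trans ([m+n]%n≡m%n r n) (cong (_% n) (sym (+-identityʳ r)))

complement : List ℕ → List ℕ
complement = map (1 ∸_)

·-complement : ∀ {p} → All (_≤ 1) p → ∀ φ →
               (complement p · φ) + (p · φ) ≡ (replicate (length p) 1 · φ)
·-complement []                φ = refl
·-complement {a ∷ p} (a≤1 ∷ p≤1) φ = begin
  ((1 ∸ a) * φ 0 + c) + (a * φ 0 + t)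
    ≡⟨ regroup (1 ∸ a) a (φ 0) c t ⟩
  ((1 ∸ a) + a) * φ 0 + (c + t)
    ≡⟨ cong₂ (λ x y → x * φ 0 + y) (m∸n+n≡m a≤1) (·-complement p≤1 (φ ∘ suc)) ⟩
  1 * φ 0 + (replicate (length p) 1 · (φ ∘ suc)) ∎
  where
  open ≡-Reasoning
  c = complement p · (φ ∘ suc)
  t = p · (φ ∘ suc)
  regroup : ∀ b a x c t → (b * x + c) + (a * x + t) ≡ (b + a) * x + (c + t)
  regroup = solve-∀

total-replicate-1 : ∀ n → total (replicate n 1) ≡ n
total-replicate-1 zero    = refl
total-replicate-1 (suc n) = cong suc (total-replicate-1 n)

total-complement : ∀ {p} → All (_≤ 1) p → total (complement p) + total p ≡ length p
total-complement {p} p≤1 = trans (·-complement p≤1 _) (total-replicate-1 (length p))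

-- With f = 1 - p and convolution taken modulo n, f * f = f * 1 - 1 * p + p * p.
sq-complement : ∀ {n} .{{_ : NonZero n}} {p} → All (_≤ 1) p → length p ≡ n → ∀ m →
  sq (complement p) (χ n m) + total p ≡ total (complement p) + sq p (χ n m)
sq-complement {n} {p} p≤1 refl m = begin
  sq f (χ n m) + total p
    ≡⟨ cong (λ x → sq f (χ n m) + x) column ⟨
  sq f (χ n m) + (Y + sq p (χ n m))
    ≡⟨ +-assoc (sq f (χ n m)) Y _ ⟨
  sq f (χ n m) + Y + sq p (χ n m)
    ≡⟨ cong (_+ sq p (χ n m)) row ⟩
  total f + sq p (χ n m) ∎
  where
  open ≡-Reasoning
  f = complement p
  Y = f · λ i → p · λ j → χ n m (i + j)
  row : sq f (χ n m) + Y ≡ total f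
  row = trans (sym (·-+ f _ _))
              (·-cong f λ i → trans (·-complement p≤1 _) (period n m i))
  column : Y + sq p (χ n m) ≡ total p
  column = begin
    Y + sq p (χ n m)
      ≡⟨ cong₂ _+_ (·-swap f p _) (·-swap p p _) ⟩
    (p · λ j → f · λ i → χ n m (i + j)) + (p · λ j → p · λ i → χ n m (i + j))
      ≡⟨ ·-+ p _ _ ⟨
    (p · λ j → (f · λ i → χ n m (i + j)) + (p · λ i → χ n m (i + j)))
      ≡⟨ ·-cong p (λ j → trans (·-complement p≤1 _)
           (trans (·-cong (replicate n 1) λ i → cong (χ n m) (+-comm i j)) (period n m j))) ⟩
    total p ∎

-- Integer polynomials

⊗-≤1 : ∀ {h f} → All (_≤ 1) h → All (_≤ 1) f → All (_≤ 1) (h ⊗ f)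
⊗-≤1 []          f≤1 = []
⊗-≤1 (b≤1 ∷ h≤1) f≤1 =
  All.++⁺ (All.map⁺ (All.map (*-mono-≤ b≤1) f≤1)) (⊗-≤1 h≤1 f≤1)

complement-≤1 : ∀ p → All (_≤ 1) (complement p)
complement-≤1 p = All.map⁺ (All.universal (m∸n≤m 1) p)

-- Coefficient lists may have trailing zeros; a final 1 makes the length of the witness the exact
-- degree.
EndsInOne : List ℕ → Set
EndsInOne p = ∃[ q ] (p ≡ q ++ 1 ∷ [])

⊗-endsInOne : ∀ {h f} → EndsInOne h → EndsInOne f → EndsInOne (h ⊗ f)
⊗-endsInOne {f = f} (h′ , refl) (f′ , f≡) = (h′ ⊗ f) ++ f′ , (begin
  (h′ ++ 1 ∷ []) ⊗ f
    ≡⟨ concatMap-++ _ h′ (1 ∷ []) ⟩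
  (h′ ⊗ f) ++ map (1 *_) f ++ []
    ≡⟨ cong ((h′ ⊗ f) ++_) (trans (++-identityʳ _) (trans (map-cong *-identityˡ f) (map-id f))) ⟩
  (h′ ⊗ f) ++ f
    ≡⟨ cong ((h′ ⊗ f) ++_) f≡ ⟩
  (h′ ⊗ f) ++ f′ ++ 1 ∷ []
    ≡⟨ ++-assoc (h′ ⊗ f) f′ _ ⟨
  ((h′ ⊗ f) ++ f′) ++ 1 ∷ [] ∎)
  where open ≡-Reasoning

replicate-snoc : ∀ z (x : ℕ) → replicate (suc z) x ≡ replicate z x ++ x ∷ []
replicate-snoc zero    x = refl
replicate-snoc (suc z) x = cong (x ∷_) (replicate-snoc z x)

-- The last padding zero becomes the leading 1; `suc z` guarantees that there is one.
complement-endsInOne : ∀ p z → EndsInOne (complement (p ++ replicate (suc z) 0))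
complement-endsInOne p z = complement (p ++ replicate z 0) , (begin
  complement (p ++ replicate (suc z) 0)
    ≡⟨ cong (complement ∘ (p ++_)) (replicate-snoc z 0) ⟩
  complement (p ++ replicate z 0 ++ 0 ∷ [])
    ≡⟨ cong complement (++-assoc p (replicate z 0) _) ⟨
  complement ((p ++ replicate z 0) ++ 0 ∷ [])
    ≡⟨ map-++ (1 ∸_) (p ++ replicate z 0) _ ⟩
  complement (p ++ replicate z 0) ++ 1 ∷ [] ∎)
  where open ≡-Reasoning

toPoly : List ℕ → Poly
toPoly = map λ a → + a

toPoly-newman : ∀ {p} → All (_≤ 1) p → Newman (toPoly p)
toPoly-newman []              k       = inj₁ refl
toPoly-newman (z≤n     ∷ p≤1) zero    = inj₁ refl
toPoly-newman (s≤s z≤n ∷ p≤1) zero    = inj₂ refl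
toPoly-newman (_       ∷ p≤1) (suc k) = toPoly-newman p≤1 k

toPoly-hasDegree : ∀ q → HasDegree (toPoly (q ++ 1 ∷ [])) (length q)
toPoly-hasDegree []      = (λ ()) , λ { (suc k) _ → refl }
toPoly-hasDegree (a ∷ q) = let top , above = toPoly-hasDegree q in
  top , λ { (suc k) n<k → above k (s<s⁻¹ n<k) }

coeff-+ₚ : ∀ p q k → coeff (p +ₚ q) k ≡ coeff p k ℤ.+ coeff q k
coeff-+ₚ []      q       k       = sym (ℤ.+-identityˡ _)
coeff-+ₚ (a ∷ p) []      k       = sym (ℤ.+-identityʳ _)
coeff-+ₚ (a ∷ p) (b ∷ q) zero    = refl
coeff-+ₚ (a ∷ p) (b ∷ q) (suc k) = coeff-+ₚ p q k

coeff-map-* : ∀ a p k → coeff (map (a ℤ.*_) p) k ≡ a ℤ.* coeff p k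
coeff-map-* a []      k       = sym (ℤ.*-zeroʳ a)
coeff-map-* a (b ∷ p) zero    = refl
coeff-map-* a (b ∷ p) (suc k) = coeff-map-* a p k

coeff-toPoly : ∀ p k → coeff (toPoly p) k ≡ + (p · δ k)
coeff-toPoly []      k       = refl
coeff-toPoly (a ∷ p) zero    =
  cong (λ a → + a) (sym (trans (cong₂ _+_ (*-identityʳ a) (·-zero p)) (+-identityʳ a)))
coeff-toPoly (a ∷ p) (suc k) =
  trans (coeff-toPoly p k) (cong (λ x → + (x + (p · δ k))) (sym (*-zeroʳ a)))

-- Ties polynomial multiplication to weighted sums: for p = q the right side is `sq p (δ k)`.
coeff-*ₚ : ∀ p q k →
           coeff (toPoly p *ₚ toPoly q) k ≡ + (p · λ i → q · λ j → δ k (i + j))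
coeff-*ₚ []      q k = refl
coeff-*ₚ (a ∷ p) q k = begin
  coeff (map (+ a ℤ.*_) (toPoly q) +ₚ (0ℤ ∷ toPoly p *ₚ toPoly q)) k
    ≡⟨ coeff-+ₚ (map (+ a ℤ.*_) (toPoly q)) _ k ⟩
  coeff (map (+ a ℤ.*_) (toPoly q)) k ℤ.+ coeff (0ℤ ∷ toPoly p *ₚ toPoly q) k
    ≡⟨ cong₂ ℤ._+_ (trans (coeff-map-* (+ a) (toPoly q) k) (cong (+ a ℤ.*_) (coeff-toPoly q k)))
                   (shifted k) ⟩
  + a ℤ.* + (q · δ k) ℤ.+ + (p · λ i → q · λ j → δ k (suc i + j))
    ≡⟨ cong (ℤ._+ + (p · λ i → q · λ j → δ k (suc i + j))) (ℤ.pos-* a (q · δ k)) ⟨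
  + (a * (q · δ k) + (p · λ i → q · λ j → δ k (suc i + j))) ∎
  where
  open ≡-Reasoning
  shifted : ∀ k → coeff (0ℤ ∷ toPoly p *ₚ toPoly q) k
                ≡ + (p · λ i → q · λ j → δ k (suc i + j))
  -- A multiple of x has no constant term, just as `δ 0` vanishes on successors.
  shifted zero    = cong (λ a → + a) (sym (trans (·-cong p λ _ → ·-zero q) (·-zero p)))
  shifted (suc k) = coeff-*ₚ p q k

‖‖∞-≤ : ∀ p {c} → (∀ k → ℤ.∣ coeff p k ∣ ≤ c) → ‖ p ‖∞ ≤ c
‖‖∞-≤ []      h = z≤n
‖‖∞-≤ (a ∷ p) h = ⊔-lub (h 0) (‖‖∞-≤ p (h ∘ suc))

‖toPoly²‖∞-≤ : ∀ p {c} → Bounded c p → ‖ toPoly p ² ‖∞ ≤ c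
‖toPoly²‖∞-≤ p bp = ‖‖∞-≤ (toPoly p ²) λ k →
  ≤-trans (≤-reflexive (cong ℤ.∣_∣ (coeff-*ₚ p p k))) (bp k)

eval-+ₚ : ∀ p q x → eval (p +ₚ q) x ≡ eval p x ℤ.+ eval q x
eval-+ₚ []      q       x = sym (ℤ.+-identityˡ _)
eval-+ₚ (a ∷ p) []      x = sym (ℤ.+-identityʳ _)
eval-+ₚ (a ∷ p) (b ∷ q) x rewrite eval-+ₚ p q x = regroup a b x (eval p x) (eval q x)
  where
  regroup : ∀ a b x s t → (a ℤ.+ b) ℤ.+ x ℤ.* (s ℤ.+ t)
                        ≡ (a ℤ.+ x ℤ.* s) ℤ.+ (b ℤ.+ x ℤ.* t)
  regroup = ℤ-Solver.solve-∀

eval-map-* : ∀ a p x → eval (map (a ℤ.*_) p) x ≡ a ℤ.* eval p x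
eval-map-* a []      x = sym (ℤ.*-zeroʳ a)
eval-map-* a (b ∷ p) x rewrite eval-map-* a p x = regroup a b x (eval p x)
  where
  regroup : ∀ a b x s → a ℤ.* b ℤ.+ x ℤ.* (a ℤ.* s) ≡ a ℤ.* (b ℤ.+ x ℤ.* s)
  regroup = ℤ-Solver.solve-∀

eval-*ₚ : ∀ p q x → eval (p *ₚ q) x ≡ eval p x ℤ.* eval q x
eval-*ₚ []      q x = refl
eval-*ₚ (a ∷ p) q x
  rewrite eval-+ₚ (map (a ℤ.*_) q) (0ℤ ∷ p *ₚ q) x | eval-map-* a q x | eval-*ₚ p q x
  = regroup a x (eval p x) (eval q x)
  where
  regroup : ∀ a x s t → a ℤ.* t ℤ.+ (0ℤ ℤ.+ x ℤ.* (s ℤ.* t)) ≡ (a ℤ.+ x ℤ.* s) ℤ.* t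
  regroup = ℤ-Solver.solve-∀

eval-toPoly : ∀ p → eval (toPoly p) 1ℤ ≡ + total p
eval-toPoly []      = refl
eval-toPoly (a ∷ p) rewrite eval-toPoly p | *-identityʳ a = cong (λ x → + a ℤ.+ x) (ℤ.*-identityˡ (+ total p))

eval-toPoly-² : ∀ p → eval (toPoly p ²) 1ℤ ≡ + (total p * total p)
eval-toPoly-² p rewrite eval-*ₚ (toPoly p) (toPoly p) 1ℤ | eval-toPoly p =
  sym (ℤ.pos-* (total p) (total p))

-- Numerical estimates

-- A factor f multiplies the length by F + k, the coefficient bound by R and p(1)² by F², so the
-- ratio grows by at most 1 + r/F.
cyclic-cost : ∀ {F k R r} → R ≤ F → R + k ≤ F + r → (F + k) * R ≤ F * (F + r)
cyclic-cost {F} {k} {R} {r} R≤F R+k≤F+r = begin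
  (F + k) * R    ≡⟨ *-distribʳ-+ R F k ⟩
  F * R + k * R  ≤⟨ +-monoʳ-≤ (F * R) (*-monoʳ-≤ k R≤F) ⟩
  F * R + k * F  ≡⟨ cong (λ x → F * R + x) (*-comm k F) ⟩
  F * R + F * k  ≡⟨ *-distribˡ-+ F R k ⟨
  F * (R + k)    ≤⟨ *-monoʳ-≤ F R+k≤F+r ⟩
  F * (F + r)    ∎
  where open ≤-Reasoning

-- (1 + r/F)ⁱ ≤ 1 / (1 - i r/F)
bernoulli-upper : ∀ {F r} i {x} → F ≡ x + i * r → (F + r) ^ i * x ≤ F ^ i * F
bernoulli-upper {F} {r} zero    {x} F≡ = *-monoʳ-≤ 1 (≤-trans (m≤m+n x 0) (≤-reflexive (sym F≡)))
bernoulli-upper {F} {r} (suc i) {x} F≡ = begin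
  (F + r) * (F + r) ^ i * x        ≡⟨ regroup (F + r) ((F + r) ^ i) x ⟩
  (F + r) ^ i * ((F + r) * x)      ≤⟨ *-monoʳ-≤ ((F + r) ^ i) step ⟩
  (F + r) ^ i * ((x + r) * F)      ≡⟨ *-assoc ((F + r) ^ i) (x + r) F ⟨
  (F + r) ^ i * (x + r) * F        ≤⟨ *-monoˡ-≤ F (bernoulli-upper i F≡′) ⟩
  F ^ i * F * F                    ≡⟨ cong (_* F) (*-comm (F ^ i) F) ⟩
  F * F ^ i * F                    ∎
  where
  open ≤-Reasoning
  regroup : ∀ a b x → a * b * x ≡ b * (a * x)
  regroup = solve-∀
  F≡′ : F ≡ (x + r) + i * r
  F≡′ = trans F≡ (sym (+-assoc x r (i * r)))
  x≤F : x ≤ F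
  x≤F = ≤-trans (m≤m+n x _) (≤-reflexive (sym F≡))
  step : (F + r) * x ≤ (x + r) * F
  step = begin
    (F + r) * x    ≡⟨ *-distribʳ-+ x F r ⟩
    F * x + r * x  ≤⟨ +-mono-≤ (≤-reflexive (*-comm F x)) (*-monoʳ-≤ r x≤F) ⟩
    x * F + r * F  ≡⟨ *-distribʳ-+ F x r ⟨
    (x + r) * F    ∎

-- Apply `bernoulli-upper` with x = F - mr, which is at least 16F/17.
power-close : ∀ {F r} m .{{_ : NonZero F}} → 17 * (m * r) ≤ F → 16 * (F + r) ^ m ≤ 17 * F ^ m
power-close {F} {r} m small = *-cancelʳ-≤ (16 * P) (17 * F ^ m) F (begin
  16 * P * F        ≡⟨ trans (*-assoc 16 P F) (swap 16 P F) ⟩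
  P * (16 * F)      ≤⟨ *-monoʳ-≤ P 16F≤17x ⟩
  P * (17 * x)      ≡⟨ swap P 17 x ⟩
  17 * (P * x)      ≤⟨ *-monoʳ-≤ 17 (bernoulli-upper m (sym F≡)) ⟩
  17 * (F ^ m * F)  ≡⟨ *-assoc 17 (F ^ m) F ⟨
  17 * F ^ m * F    ∎)
  where
  open ≤-Reasoning
  P = (F + r) ^ m
  x = F ∸ m * r
  swap : ∀ a b c → a * (b * c) ≡ b * (a * c)
  swap = solve-∀
  F≡ : x + m * r ≡ F
  F≡ = m∸n+n≡m (≤-trans (m≤m+n (m * r) _) small)
  16F≤17x : 16 * F ≤ 17 * x
  16F≤17x = +-cancelʳ-≤ (17 * (m * r)) (16 * F) (17 * x) (begin
    16 * F + 17 * (m * r)  ≤⟨ +-monoʳ-≤ (16 * F) small ⟩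
    16 * F + F             ≡⟨ +-comm (16 * F) F ⟩
    17 * F                 ≡⟨ cong (17 *_) F≡ ⟨
    17 * (x + m * r)       ≡⟨ *-distribˡ-+ 17 x (m * r) ⟩
    17 * x + 17 * (m * r)  ∎)

-- 1 + m k/F ≤ (1 + k/F)ᵐ
bernoulli-lower : ∀ F k m → F ^ m * (F + m * k) ≤ (F + k) ^ m * F
bernoulli-lower F k zero    = *-monoʳ-≤ 1 (≤-reflexive (+-identityʳ F))
bernoulli-lower F k (suc m) = begin
  F * F ^ m * (F + (k + m * k))            ≤⟨ m≤m+n _ (F ^ m * (k * (m * k))) ⟩
  F * F ^ m * (F + (k + m * k)) + F ^ m * (k * (m * k))
                                           ≡⟨ regroup F (F ^ m) k (m * k) ⟩
  (F + k) * (F ^ m * (F + m * k))          ≤⟨ *-monoʳ-≤ (F + k) (bernoulli-lower F k m) ⟩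
  (F + k) * ((F + k) ^ m * F)              ≡⟨ *-assoc (F + k) ((F + k) ^ m) F ⟨
  (F + k) * (F + k) ^ m * F                ∎
  where
  open ≤-Reasoning
  regroup : ∀ F P k t → F * P * (F + (k + t)) + P * (k * t) ≡ (F + k) * (P * (F + t))
  regroup = solve-∀

^-distribʳ-* : ∀ a b m → (a * b) ^ m ≡ a ^ m * b ^ m
^-distribʳ-* a b zero    = refl
^-distribʳ-* a b (suc m) rewrite ^-distribʳ-* a b m = regroup a b (a ^ m) (b ^ m)
  where
  regroup : ∀ a b x y → a * b * (x * y) ≡ a * x * (b * y)
  regroup = solve-∀

-- The starting polynomial contributes 4 · 2 / 3² = 8/9 and the m factors at most 17/16, together
-- 17/18.
ratio-bound : ∀ {F k R r} m .{{_ : NonZero F}} →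
              17 * (m * r) ≤ F → R ≤ F → R + k ≤ F + r →
              18 * ((4 * (F + k) ^ m) * (R ^ m * 2)) ≤ 17 * ((3 * F ^ m) * (3 * F ^ m))
ratio-bound {F} {k} {R} {r} m small R≤F R+k≤F+r = begin
  18 * ((4 * (F + k) ^ m) * (R ^ m * 2))
    ≡⟨ left ((F + k) ^ m) (R ^ m) ⟩
  144 * ((F + k) ^ m * R ^ m)
    ≡⟨ cong (144 *_) (^-distribʳ-* (F + k) R m) ⟨
  144 * ((F + k) * R) ^ m
    ≤⟨ *-monoʳ-≤ 144 (^-monoˡ-≤ m (cyclic-cost R≤F R+k≤F+r)) ⟩
  144 * (F * (F + r)) ^ m
    ≡⟨ cong (144 *_) (^-distribʳ-* F (F + r) m) ⟩
  144 * (F ^ m * (F + r) ^ m)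
    ≡⟨ middle (F ^ m) ((F + r) ^ m) ⟩
  9 * F ^ m * (16 * (F + r) ^ m)
    ≤⟨ *-monoʳ-≤ (9 * F ^ m) (power-close m small) ⟩
  9 * F ^ m * (17 * F ^ m)
    ≡⟨ right (F ^ m) ⟩
  17 * ((3 * F ^ m) * (3 * F ^ m)) ∎
  where
  open ≤-Reasoning
  left : ∀ x y → 18 * ((4 * x) * (y * 2)) ≡ 144 * (x * y)
  left = solve-∀
  middle : ∀ x y → 144 * (x * y) ≡ 9 * x * (16 * y)
  middle = solve-∀
  right : ∀ x → 9 * x * (17 * x) ≡ 17 * ((3 * x) * (3 * x))
  right = solve-∀

-- Bernoulli gives (1 + k/F)ˡ ≥ lk/F; with F ≤ 18lr and k/r ≥ j/2 this is at least j/36.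
density-bound : ∀ {F k r} l j .{{_ : NonZero l}} .{{_ : NonZero r}} →
                F ≤ 18 * (l * r) → j * r ≤ 2 * k → F ^ l * j ≤ 36 * (F + k) ^ l
density-bound {F} {k} {r} l j F≤ jr≤2k =
  *-cancelʳ-≤ (F ^ l * j) (36 * Q) (l * r) {{m*n≢0 l r}} (begin
    F ^ l * j * (l * r)      ≡⟨ left (F ^ l) j l r ⟩
    F ^ l * (l * (j * r))    ≤⟨ *-monoʳ-≤ (F ^ l) (*-monoʳ-≤ l jr≤2k) ⟩
    F ^ l * (l * (2 * k))    ≡⟨ middle (F ^ l) l k ⟩
    2 * (F ^ l * (l * k))    ≤⟨ *-monoʳ-≤ 2 (*-monoʳ-≤ (F ^ l) (m≤n+m (l * k) F)) ⟩
    2 * (F ^ l * (F + l * k)) ≤⟨ *-monoʳ-≤ 2 (bernoulli-lower F k l) ⟩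
    2 * (Q * F)              ≤⟨ *-monoʳ-≤ 2 (*-monoʳ-≤ Q F≤) ⟩
    2 * (Q * (18 * (l * r))) ≡⟨ right Q (l * r) ⟩
    36 * Q * (l * r)         ∎)
  where
  open ≤-Reasoning
  Q = (F + k) ^ l
  left : ∀ x j l r → x * j * (l * r) ≡ x * (l * (j * r))
  left = solve-∀
  middle : ∀ x l k → x * (l * (2 * k)) ≡ 2 * (x * (l * k))
  middle = solve-∀
  right : ∀ q y → 2 * (q * (18 * y)) ≡ 36 * q * y
  right = solve-∀

-- Supplies k/r ≥ j/2 for the iterated set; linear growth suffices.
2-3-powers : ∀ j → j * 2 ^ suc j ≤ 2 * 3 ^ suc j
2-3-powers j = begin
  j * (2 * 2 ^ j)       ≡⟨ left j (2 ^ j) ⟩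
  2 * (j * 2 ^ j)       ≤⟨ *-monoʳ-≤ 2 (*-monoˡ-≤ (2 ^ j) (m≤m+n j 2)) ⟩
  2 * ((j + 2) * 2 ^ j) ≤⟨ *-monoʳ-≤ 2 (strong j) ⟩
  2 * (2 * 3 ^ j)       ≤⟨ *-monoʳ-≤ 2 (*-monoˡ-≤ (3 ^ j) (n≤1+n 2)) ⟩
  2 * (3 * 3 ^ j)       ∎
  where
  open ≤-Reasoning
  left : ∀ j x → j * (2 * x) ≡ 2 * (j * x)
  left = solve-∀
  -- Bernoulli's inequality (3/2)ʲ ≥ 1 + j/2; the offset 2 carries the induction.
  strong : ∀ j → (j + 2) * 2 ^ j ≤ 2 * 3 ^ j
  strong zero    = ≤-refl
  strong (suc j) = begin
    (suc j + 2) * (2 * 2 ^ j)        ≤⟨ m≤m+n _ (j * 2 ^ j) ⟩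
    (suc j + 2) * (2 * 2 ^ j) + j * 2 ^ j ≡⟨ regroup j (2 ^ j) ⟩
    3 * ((j + 2) * 2 ^ j)            ≤⟨ *-monoʳ-≤ 3 (strong j) ⟩
    3 * (2 * 3 ^ j)                  ≡⟨ regroup′ (3 ^ j) ⟩
    2 * (3 * 3 ^ j)                  ∎
    where
    regroup : ∀ j x → (1 + j + 2) * (2 * x) + j * x ≡ 3 * ((j + 2) * x)
    regroup = solve-∀
    regroup′ : ∀ x → 3 * (2 * x) ≡ 2 * (3 * x)
    regroup′ = solve-∀

-- The construction

golomb : List ℕ
golomb = 1 ∷ 1 ∷ 0 ∷ 1 ∷ []

golomb-≤1 : All (_≤ 1) golomb
golomb-≤1 = s≤s z≤n ∷ s≤s z≤n ∷ z≤n ∷ s≤s z≤n ∷ []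

-- The exponents 0, 1, 3 form a Golomb ruler, so their pairwise sums are distinct up to order: the
-- square is 1 + 2x + x² + 2x³ + 2x⁴ + x⁶.
golomb-bounded : Bounded 2 golomb
golomb-bounded 0 = s≤s z≤n
golomb-bounded 1 = ≤-refl
golomb-bounded 2 = s≤s z≤n
golomb-bounded 3 = ≤-refl
golomb-bounded 4 = ≤-refl
golomb-bounded 5 = z≤n
golomb-bounded 6 = s≤s z≤n
golomb-bounded (suc (suc (suc (suc (suc (suc (suc m))))))) = z≤n

-- Characteristic list of the numbers with j + 1 base-8 digits, all in {0, 1, 3}. Sums of two such
-- digits are at most 6 and never carry.
sparse : ℕ → List ℕ
sparse zero    = golomb
sparse (suc j) = sparse j ⊗ (golomb ++ replicate 4 0)

sparse-≤1 : ∀ j → All (_≤ 1) (sparse j)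
sparse-≤1 zero    = golomb-≤1
sparse-≤1 (suc j) = ⊗-≤1 (sparse-≤1 j) (All.++⁺ golomb-≤1 (All.replicate⁺ 4 z≤n))

sparse-bounded : ∀ j → Bounded (2 ^ suc j) (sparse j)
sparse-bounded zero    = golomb-bounded
sparse-bounded (suc j) = ⊗-bounded {8} (sparse j) _ refl (sparse-bounded j)
                           (pad-bounded golomb 4 ≤-refl golomb-bounded)

total-sparse : ∀ j → total (sparse j) ≡ 3 ^ suc j
total-sparse zero    = refl
total-sparse (suc j) = trans (total-⊗ (sparse j) _)
                             (trans (*-comm (total (sparse j)) 3) (cong (3 *_) (total-sparse j)))

total-≤-length : ∀ {p} → All (_≤ 1) p → total p ≤ length p
total-≤-length {p} p≤1 =
  ≤-trans (m≤n+m (total p) (total (complement p))) (≤-reflexive (total-complement p≤1))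

module _ (f : List ℕ) where

  -- With n the length of f, this is `golomb` at x^(n^m) times the product of f(x^(n^i)) over i < m.
  tower : ℕ → List ℕ
  tower zero    = golomb
  tower (suc m) = tower m ⊗ f

  tower-≤1 : All (_≤ 1) f → ∀ m → All (_≤ 1) (tower m)
  tower-≤1 f≤1 zero    = golomb-≤1
  tower-≤1 f≤1 (suc m) = ⊗-≤1 (tower-≤1 f≤1 m) f≤1

  tower-endsInOne : EndsInOne f → ∀ m → EndsInOne (tower m)
  tower-endsInOne ends zero    = 1 ∷ 1 ∷ 0 ∷ [] , refl
  tower-endsInOne ends (suc m) = ⊗-endsInOne (tower-endsInOne ends m) ends

  total-tower : ∀ m → total (tower m) ≡ 3 * total f ^ m
  total-tower zero    = refl
  total-tower (suc m) = trans (total-⊗ (tower m) f)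
    (trans (cong (_* total f) (total-tower m)) (regroup (total f ^ m) (total f)))
    where
    regroup : ∀ x y → 3 * x * y ≡ 3 * (y * x)
    regroup = solve-∀

  length-tower : ∀ m → length (tower m) ≡ 4 * length f ^ m
  length-tower zero    = refl
  length-tower (suc m) = trans (length-⊗ (tower m) f)
    (trans (cong (_* length f) (length-tower m)) (regroup (length f ^ m) (length f)))
    where
    regroup : ∀ x y → 4 * x * y ≡ 4 * (y * x)
    regroup = solve-∀

  tower-bounded : ∀ {n} .{{_ : NonZero n}} {r} → length f ≡ n → CyclicallyBounded n r f →
                  ∀ m → Bounded (r ^ m * 2) (tower m)
  tower-bounded         len bf zero    = golomb-bounded
  tower-bounded {r = r} len bf (suc m) = subst (λ c → Bounded c (tower (suc m)))
    (sym (*-assoc r (r ^ m) 2)) (⊗-bounded (tower m) f len (tower-bounded len bf m) bf)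

module Construction (j : ℕ) where

  -- The length `l` also serves as the number of factors. The choice of `z` then puts F between 17lr
  -- and 18lr: large enough for a total cost of at most 17/16, small enough for the density to tend
  -- to 0.
  r l k z n : ℕ
  r = 2 ^ suc j
  l = length (sparse j)
  k = total (sparse j)
  z = 17 * (l * r)
  n = suc z + l

  padded f : List ℕ
  padded = sparse j ++ replicate (suc z) 0
  f = complement padded

  -- `R` is the bound that `sq-complement` yields for the cyclic coefficients of f²; since k ≤ F,
  -- the subtraction is exact.
  F R : ℕ
  F = total f
  R = F + r ∸ k

  instance
    r≢0 : NonZero r
    r≢0 = m^n≢0 2 (suc j)

  r≤k : r ≤ k
  r≤k = ≤-trans (^-monoˡ-≤ (suc j) (n≤1+n 2)) (≤-reflexive (sym (total-sparse j)))

  k≤l : k ≤ l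
  k≤l = total-≤-length (sparse-≤1 j)

  1≤k : 1 ≤ k
  1≤k = ≤-trans (>-nonZero⁻¹ r) r≤k

  instance
    l≢0 : NonZero l
    l≢0 = >-nonZero (≤-trans 1≤k k≤l)

  l≤z : l ≤ z
  l≤z = ≤-trans (m≤m*n l r) (m≤n*m (l * r) 17)

  padded-≤1 : All (_≤ 1) padded
  padded-≤1 = All.++⁺ (sparse-≤1 j) (All.replicate⁺ (suc z) z≤n)

  length-padded : length padded ≡ n
  length-padded = trans (length-++ (sparse j))
    (trans (cong (λ x → l + x) (length-replicate (suc z))) (+-comm l (suc z)))

  length-f : length f ≡ n
  length-f = trans (length-map _ padded) length-padded

  total-padded : total padded ≡ k
  total-padded = ·-pad (sparse j) (suc z) _

  F+k≡n : F + k ≡ n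
  F+k≡n = trans (cong (λ x → F + x) (sym total-padded))
                (trans (total-complement padded-≤1) length-padded)

  z<F : z < F
  z<F = +-cancelʳ-≤ k (suc z) F (≤-trans (+-monoʳ-≤ (suc z) k≤l) (≤-reflexive (sym F+k≡n)))

  instance
    F≢0 : NonZero F
    F≢0 = >-nonZero (≤-trans (s≤s z≤n) z<F)

  -- Adding 1 to both sides lets k ≥ 1 absorb the extra unit in `suc z`.
  F≤18lr : F ≤ 18 * (l * r)
  F≤18lr = +-cancelʳ-≤ 1 F _ (begin
    F + 1                     ≤⟨ +-monoʳ-≤ F 1≤k ⟩
    F + k                     ≡⟨ F+k≡n ⟩
    suc z + l                 ≤⟨ +-monoʳ-≤ (suc z) (m≤m*n l r) ⟩
    suc z + l * r             ≡⟨ regroup (l * r) ⟩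
    18 * (l * r) + 1          ∎)
    where
    open ≤-Reasoning
    regroup : ∀ x → 1 + 17 * x + x ≡ 18 * x + 1
    regroup = solve-∀

  R≤F : R ≤ F
  R≤F = ≤-trans (∸-monoʳ-≤ (F + r) r≤k) (≤-reflexive (m+n∸n≡m F r))

  R+k≤F+r : R + k ≤ F + r
  R+k≤F+r = ≤-reflexive (m∸n+n≡m
    (≤-trans k≤l (≤-trans l≤z (≤-trans (<⇒≤ z<F) (m≤m+n F r)))))

  f-bounded : CyclicallyBounded n R f
  f-bounded m = m+n≤o⇒m≤o∸n (sq f (χ n m)) (begin
    sq f (χ n m) + k             ≡⟨ cong (λ x → sq f (χ n m) + x) total-padded ⟨
    sq f (χ n m) + total padded  ≡⟨ sq-complement padded-≤1 length-padded m ⟩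
    F + sq padded (χ n m)        ≤⟨ +-monoʳ-≤ F (pad-bounded (sparse j) (suc z) 2l≤n (sparse-bounded j) m) ⟩
    F + r                        ∎)
    where
    open ≤-Reasoning
    -- The padding is longer than l, so squaring `sparse j` does not wrap around modulo n.
    2l≤n : l + l ≤ n
    2l≤n = +-monoˡ-≤ l (m≤n⇒m≤1+n l≤z)

  p : List ℕ
  p = tower f l

  p-≤1 : All (_≤ 1) p
  p-≤1 = tower-≤1 f (complement-≤1 padded) l

  p-endsInOne : EndsInOne p
  p-endsInOne = tower-endsInOne f (complement-endsInOne (sparse j) z) l

  N : ℕ
  N = length (proj₁ p-endsInOne)

  p-hasDegree : HasDegree (toPoly p) N
  p-hasDegree = subst (λ q → HasDegree (toPoly q) N) (sym (proj₂ p-endsInOne))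
                      (toPoly-hasDegree (proj₁ p-endsInOne))

  1+N≡ : suc N ≡ 4 * n ^ l
  1+N≡ = begin
    suc N                              ≡⟨ +-comm 1 N ⟩
    N + 1                              ≡⟨ length-++ (proj₁ p-endsInOne) ⟨
    length (proj₁ p-endsInOne ++ 1 ∷ []) ≡⟨ cong length (proj₂ p-endsInOne) ⟨
    length p                           ≡⟨ length-tower f l ⟩
    4 * length f ^ l                   ≡⟨ cong (λ x → 4 * x ^ l) length-f ⟩
    4 * n ^ l                          ∎
    where open ≡-Reasoning

  -- The degree is 4nˡ - 1; giving up one of the four copies of nˡ covers the missing 1.
  3nˡ≤N : 3 * n ^ l ≤ N
  3nˡ≤N = s≤s⁻¹ (≤-trans (+-monoˡ-≤ (3 * n ^ l) (m^n>0 n l)) (≤-reflexive (sym 1+N≡)))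

  0<N : 0 < N
  0<N = ≤-trans (m^n>0 n l) (≤-trans (m≤n*m (n ^ l) 3) 3nˡ≤N)

  ratio : 18 * (N * ‖ toPoly p ² ‖∞) ≤ 17 * (total p * total p)
  ratio = begin
    18 * (N * ‖ toPoly p ² ‖∞)
      ≤⟨ *-monoʳ-≤ 18 (*-mono-≤ (≤-trans (n≤1+n N) (≤-reflexive 1+N≡))
           (‖toPoly²‖∞-≤ p (tower-bounded f length-f f-bounded l))) ⟩
    18 * ((4 * n ^ l) * (R ^ l * 2))
      ≡⟨ cong (λ x → 18 * ((4 * x ^ l) * (R ^ l * 2))) F+k≡n ⟨
    18 * ((4 * (F + k) ^ l) * (R ^ l * 2))
      ≤⟨ ratio-bound l (<⇒≤ z<F) R≤F R+k≤F+r ⟩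
    17 * ((3 * F ^ l) * (3 * F ^ l))
      ≡⟨ cong (λ x → 17 * (x * x)) (total-tower f l) ⟨
    17 * (total p * total p) ∎
    where open ≤-Reasoning

  -- Amounts to p(1)/N ≤ 36/j for positive j: the factor 3 from `golomb` cancels against 3nˡ ≤ N.
  density : total p * j ≤ 36 * N
  density = begin
    total p * j               ≡⟨ cong (_* j) (total-tower f l) ⟩
    3 * F ^ l * j             ≡⟨ *-assoc 3 (F ^ l) j ⟩
    3 * (F ^ l * j)           ≤⟨ *-monoʳ-≤ 3 (density-bound l j F≤18lr jr≤2k) ⟩
    3 * (36 * (F + k) ^ l)    ≡⟨ cong (λ x → 3 * (36 * x ^ l)) F+k≡n ⟩
    3 * (36 * n ^ l)          ≡⟨ swap (n ^ l) ⟩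
    36 * (3 * n ^ l)          ≤⟨ *-monoʳ-≤ 36 3nˡ≤N ⟩
    36 * N                    ∎
    where
    open ≤-Reasoning
    swap : ∀ x → 3 * (36 * x) ≡ 36 * (3 * x)
    swap = solve-∀
    jr≤2k : j * r ≤ 2 * k
    jr≤2k = subst (λ x → j * r ≤ 2 * x) (sym (total-sparse j)) (2-3-powers j)

  -- Matches the constant in `density`, so that it cancels in `j≤N`; it also gives p(1) > 0.
  36≤total : 36 ≤ total p
  36≤total = begin
    3 * 12     ≤⟨ *-monoʳ-≤ 3 12≤F ⟩
    3 * F      ≡⟨ cong (3 *_) (^-identityʳ F) ⟨
    3 * F ^ 1  ≤⟨ *-monoʳ-≤ 3 (^-monoʳ-≤ F (>-nonZero⁻¹ l)) ⟩
    3 * F ^ l  ≡⟨ total-tower f l ⟨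
    total p    ∎
    where
    open ≤-Reasoning
    12≤F : 12 ≤ F
    12≤F = ≤-trans (m≤m+n 12 5) (≤-trans (m≤m*n 17 (l * r) {{m*n≢0 l r}}) (<⇒≤ z<F))

  j≤N : j ≤ N
  j≤N = *-cancelˡ-≤ 36 (≤-trans (*-monoˡ-≤ j 36≤total) density)

-- The infinite set of degrees

degree : ℕ → ℕ
degree j = Construction.N j

newman : ℕ → Poly
newman j = toPoly (Construction.p j)

-- Only finitely many indices lie below J, and M is chosen above all their values. This turns large
-- degrees into large indices.
indices-escape : ∀ (a : ℕ → ℕ) J → ∃[ M ] (∀ j → M ≤ a j → J ≤ j)
indices-escape a zero    = 0 , λ _ _ → z≤n
indices-escape a (suc J) = let M , escape = indices-escape a J in
  M ⊔ suc (a J) , λ j h → ≤∧≢⇒<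
    (escape j (m⊔n≤o⇒m≤o M (suc (a J)) h))
    (λ { refl → <-irrefl refl (m⊔n≤o⇒n≤o M (suc (a J)) h) })

-- The bound on j, available from `j≤N`, makes membership a finite search and hence decidable, which
-- `poly` relies on.
Degrees : Pred ℕ 0ℓ
Degrees N = ∃[ j ] (j < suc N × degree j ≡ N)

degree∈ : ∀ j → degree j ∈ Degrees
degree∈ j = j , s≤s (Construction.j≤N j) , refl

degrees? : ∀ N → Dec (N ∈ Degrees)
degrees? N = anyUpTo? (λ j → degree j ≟ N) (suc N)

poly : ℕ → Poly
poly N with degrees? N
... | yes (j , _) = newman j
-- An arbitrary value outside the set of degrees.
... | no  _       = []

-- The search may find another index than the one in the membership proof, so the property is
-- required at every index.
poly-elim : (P : ℕ → Poly → Set) → (∀ j → P (degree j) (newman j)) →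
            ∀ N → N ∈ Degrees → P N (poly N)
poly-elim P base N N∈ with degrees? N
... | yes (j , _ , refl) = base j
... | no  N∉             = contradiction N∈ N∉

-- Rational quotients and the two limits

÷-< : ∀ a b c d → 0 < b → a * suc d < c * b → (+ a ÷ + b) ℚ.< (+ c ℚ./ suc d)
÷-< a (suc b) c d _ ad<cb = ℚ.toℚᵘ-cancel-<
  (ℚᵘ.<-respˡ-≃ (ℚᵘ.≃-sym (ℚ.toℚᵘ-fromℚᵘ (mkℚᵘ (+ a) b)))
  (ℚᵘ.<-respʳ-≃ (ℚᵘ.≃-sym (ℚ.toℚᵘ-fromℚᵘ (mkℚᵘ (+ c) d)))
  (ℚᵘ.*<* (subst₂ ℤ._<_ (ℤ.pos-* a (suc d)) (ℤ.pos-* c (suc b)) (+<+ ad<cb)))))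

∣÷-0∣ : ∀ a b → ℚ.∣ (+ a ÷ + b) ℚ.- 0ℚ ∣ ≡ + a ÷ + b
∣÷-0∣ a zero    = refl
∣÷-0∣ a (suc b) = trans (cong ℚ.∣_∣ (ℚ.+-identityʳ _))
  (ℚ.0≤p⇒∣p∣≡p (ℚ.nonNegative⁻¹ _ {{ℚ.normalize-nonNeg a (suc b)}}))

-- The weak bound 17/18 from `ratio` is relaxed to a strict one that still lies below 1, as the
-- upper cuts in the lower limit demand.
ratio<18/19 : ∀ N → N ∈ Degrees →
  (+ N ℤ.* + ‖ poly N ² ‖∞) ÷ eval (poly N ²) 1ℤ ℚ.< + 18 ℚ./ 19
ratio<18/19 = poly-elim
  (λ N q → (+ N ℤ.* + ‖ q ² ‖∞) ÷ eval (q ²) 1ℤ ℚ.< + 18 ℚ./ 19) base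
  where
  base : ∀ j → (+ degree j ℤ.* + ‖ newman j ² ‖∞) ÷ eval (newman j ²) 1ℤ ℚ.< + 18 ℚ./ 19
  base j rewrite eval-toPoly-² (Construction.p j)
               | sym (ℤ.pos-* (degree j) ‖ newman j ² ‖∞) = ÷-< X T² 18 18 0<T² (*-cancelˡ-< 18 _ _ (begin-strict
    18 * (X * 19)    ≡⟨ left X ⟩
    19 * (18 * X)    ≤⟨ *-monoʳ-≤ 19 ratio ⟩
    19 * (17 * T²)   ≡⟨ *-assoc 19 17 T² ⟨
    -- Since 17 · 19 = 323 and 18 · 18 = 324, this is 17/18 < 18/19; strictness uses p(1) > 0.
    323 * T²         <⟨ *-monoˡ-< T² {{>-nonZero 0<T²}} (n<1+n 323) ⟩
    324 * T²         ≡⟨ *-assoc 18 18 T² ⟩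
    18 * (18 * T²)   ∎))
    where
    open ≤-Reasoning
    open Construction j
    X = N * ‖ newman j ² ‖∞
    T² = total p * total p
    0<T : 0 < total p
    0<T = ≤-trans (s≤s z≤n) 36≤total
    0<T² : 0 < T²
    0<T² = *-mono-≤ 0<T 0<T
    left : ∀ x → 18 * (x * 19) ≡ 19 * (18 * x)
    left = solve-∀

-- For ε = (a + 1)/(d + 1), indices j ≥ 37(d + 1) give p(1)/N ≤ 36/j < 1/(d + 1) ≤ ε; taking 37
-- instead of 36 makes this strict.
density→0 : Converges Degrees (λ N → eval (poly N) 1ℤ ÷ + N) 0ℚ
density→0 (mkℚ (+ zero)  d c) (ℚ.*<* (+<+ ()))
density→0 (mkℚ -[1+ _ ]  d c) (ℚ.*<* ())
density→0 ε@(mkℚ (+ suc a) d c) _ =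
  let M , escape = indices-escape degree (37 * suc d) in
  M , λ N M≤N N∈ → poly-elim
    (λ N q → M ≤ N → ℚ.∣ eval q 1ℤ ÷ + N ℚ.- 0ℚ ∣ ℚ.< ε)
    (λ j M≤N → small j (escape j M≤N)) N N∈ M≤N
  where
  small : ∀ j → 37 * suc d ≤ j → ℚ.∣ eval (newman j) 1ℤ ÷ + degree j ℚ.- 0ℚ ∣ ℚ.< ε
  small j J≤j rewrite eval-toPoly (Construction.p j) | ∣÷-0∣ (total (Construction.p j)) (degree j) =
    subst (λ x → + T ÷ + N ℚ.< x) (ℚ.fromℚᵘ-toℚᵘ ε)
      (÷-< T N (suc a) d 0<N (<-≤-trans (*-cancelˡ-< 37 _ _ (begin-strict
        37 * (T * suc d)  ≡⟨ left T (suc d) ⟩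
        T * (37 * suc d)  ≤⟨ *-monoʳ-≤ T J≤j ⟩
        T * j             ≤⟨ density ⟩
        36 * N            <⟨ *-monoˡ-< N {{>-nonZero 0<N}} (n<1+n 36) ⟩
        37 * N            ∎)) (m≤n*m N (suc a))))
    where
    open ≤-Reasoning
    open Construction j
    T = total p
    left : ∀ x y → 37 * (x * y) ≡ x * (37 * y)
    left = solve-∀

mainTheorem2 : Σ[ S ∈ Pred ℕ 0ℓ ] Σ[ p ∈ (ℕ → Poly) ]
    ( Infinite S
    × (∀ N → N ∈ S → 0 < N)
    × (∀ N → N ∈ S → Newman (p N) × HasDegree (p N) N)
    × liminf S (λ N → (+ N ℤ.* + ‖ p N ² ‖∞) ÷ eval (p N ²) 1ℤ) <ᵘ 1ℚ
    × Converges S (λ N → eval (p N) 1ℤ ÷ + N) 0ℚ )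
mainTheorem2 = Degrees , poly
  , (λ M → degree M , Construction.j≤N M , degree∈ M)
  , poly-elim (λ N _ → 0 < N) Construction.0<N
  , poly-elim (λ N q → Newman q × HasDegree q N)
      (λ j → toPoly-newman (Construction.p-≤1 j) , Construction.p-hasDegree j)
  -- All terms lie below 18/19 < 1, so in each tail the single element `degree M`, which is at least
  -- M, bounds the infimum.
  , (+ 18 ℚ./ 19 , ℚ.*<* (+<+ ≤-refl) , λ M →
      (degree M , Construction.j≤N M , degree∈ M) , ratio<18/19 (degree M) (degree∈ M))
  , density→0
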